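{- For every three integers $\ell$, $k$, and $p$ satisfying $1 \le \ell \le k\le p \le \ell+k$, there exist caterpillars $G_1$ and $G_2$ such that $$\max\{a_1(G_1), a_1(G_2)\}=k, \quad a_1(G_1\cup G_2)=p, \quad \text{and} \quad a_1(G_1)+a_1(G_2)=k + \ell,$$ where $G_1\cup G_2$ denotes the disjoint union of $G_1$ and $G_2$.
   Context: All graphs are finite, simple, and have at least one vertex. A caterpillar is a tree in which a single path is incident to (or contains) every edge. The disjoint union of two (vertex-disjoint) graphs $G$ and $H$ has vertex set $V(G)\cup V(H)$ and edge set $E(G)\cup E(H)$. A clique of a graph $G$ is an inclusion-wise maximal complete subgraph (an isolated vertex is a clique of size 1). The $(a,b)$-monochromatic clique transversal game ($(a,b)$-MCT game) on $G$ is played by Alice and Bob, who alternately take turns: in each of her turns Alice chooses $a$ unplayed vertices and colors them red, and in each of his turns Bob chooses $b$ unplayed vertices and colors them blue (if fewer unplayed vertices remain, the player colors all of them). Alice wins if the red vertices contain at least one vertex of each clique of $G$; Bob wins if all vertices of some clique of $G$ are blue. The game is Alice-start if Alice moves first. The threshold $a_1(G)$ is the smallest positive integer $a$ such that Alice has a winning strategy in the Alice-start $(a,1)$-MCT game on $G$. -}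

module Defs where

open import Data.Fin using (Fin; splitAt)
open import Data.Fin.Subset using (Subset; _∈_; _⊆_; _∪_; _∩_; ∁; ∣_∣; ⊥; Nonempty)
open import Data.List using (List; []; _∷_; _∷ʳ_; length)
open import Data.List.Membership.Propositional using () renaming (_∈_ to _∈ˡ_)
open import Data.List.Relation.Unary.Linked using (Linked)
open import Data.List.Relation.Unary.Unique.Propositional using (Unique)
open import Data.Nat using (ℕ; _+_; _≤_; _<_; _⊓_)
open import Data.Nat.Properties using (m≤n⇒m≤n+o)
open import Data.Product using (Σ-syntax; _×_)
open import Data.Sum using (_⊎_)
open import Data.Sum.Relation.Binary.Pointwise using (Pointwise; ⊎-decidable; ⊎-symmetric)
open import Level using (0ℓ)
open import Relation.Binary.Construct.Closure.ReflexiveTransitive using (Star)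
open import Relation.Binary.Core using (Rel)
open import Relation.Binary.Definitions using (Decidable; Symmetric)
open import Relation.Binary.PropositionalEquality using (_≡_; _≢_)
open import Relation.Nullary using (¬_)

record Graph : Set₁ where
  field
    order     : ℕ
    nonempty  : 0 < order
    Adj       : Rel (Fin order) 0ℓ
    adj?      : Decidable Adj
    adj-sym   : Symmetric Adj
    adj-irref : ∀ {v} → ¬ Adj v v

  Vertex : Set
  Vertex = Fin order

open Graph using (Vertex; order)

-- Vertices of G come first in Fin (order G + order H); no edge joins G to H
-- because Pointwise never relates different injections.
infixr 6 _⊕_
_⊕_ : Graph → Graph → Graph
G ⊕ H = record
  { order     = G.order + H.order
  ; nonempty  = m≤n⇒m≤n+o H.order G.nonempty
  ; Adj       = λ x y → Pointwise G.Adj H.Adj (splitAt G.order x) (splitAt G.order y)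
  ; adj?      = λ x y → ⊎-decidable G.adj? H.adj? (splitAt G.order x) (splitAt G.order y)
  ; adj-sym   = ⊎-symmetric G.adj-sym H.adj-sym
  ; adj-irref = λ {v} → irref (splitAt G.order v)
  }
  where
  module G = Graph G
  module H = Graph H
  open import Data.Sum.Relation.Binary.Pointwise using (inj₁; inj₂)

  irref : ∀ s → ¬ Pointwise G.Adj H.Adj s s
  irref _ (inj₁ e) = G.adj-irref e
  irref _ (inj₂ e) = H.adj-irref e

module _ (G : Graph) where
  open Graph G using (Adj)

  Connected : Set
  Connected = ∀ u v → Star Adj u v

  IsPath : List (Vertex G) → Set
  IsPath vs = vs ≢ [] × Linked Adj vs × Unique vs

  -- The cycle v, vs, back to v, of length at least 3.
  IsCycle : Vertex G → List (Vertex G) → Set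
  IsCycle v vs = 2 ≤ length vs × Unique (v ∷ vs) × Linked Adj (v ∷ vs ∷ʳ v)

  Acyclic : Set
  Acyclic = ∀ v vs → ¬ IsCycle v vs

  IsTree : Set
  IsTree = Connected × Acyclic

  IsCaterpillar : Set
  IsCaterpillar =
    IsTree ×
    Σ[ vs ∈ List (Vertex G) ]
      IsPath vs × (∀ u v → Adj u v → u ∈ˡ vs ⊎ v ∈ˡ vs)

  IsComplete : Subset (order G) → Set
  IsComplete S = ∀ {u v} → u ∈ S → v ∈ S → u ≢ v → Adj u v

  -- A clique is nonempty: G has a vertex, and singletons are complete, so ∅ is
  -- not maximal.
  IsClique : Subset (order G) → Set
  IsClique S = IsComplete S × (∀ T → IsComplete T → S ⊆ T → T ⊆ S)

  RedTransversal : Subset (order G) → Set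
  RedTransversal red = ∀ K → IsClique K → Nonempty (K ∩ red)

  -- A player entitled to c vertices colours exactly the set M; when fewer than
  -- c vertices are unplayed, M consists of all of them.
  LegalMove : ℕ → (red blue M : Subset (order G)) → Set
  LegalMove c red blue M = M ⊆ unplayed × ∣ M ∣ ≡ c ⊓ ∣ unplayed ∣
    where unplayed = ∁ (red ∪ blue)

  -- Elements of AliceToMove a b red blue are Alice's winning strategies, as
  -- strategy trees, from the position (red, blue) with Alice to move; likewise
  -- BobToMove with Bob to move.  Since the trees are well-founded, every play
  -- following one reaches a red transversal after finitely many turns.  Bob's
  -- victory needs no clause: red and blue stay disjoint, so once some clique is
  -- entirely blue no later red set meets it, and no tree exists.
  mutual
    data AliceToMove (a b : ℕ) (red blue : Subset (order G)) : Set where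
      won  : RedTransversal red → AliceToMove a b red blue
      move : ∀ M → LegalMove a red blue M →
             BobToMove a b (red ∪ M) blue → AliceToMove a b red blue

    data BobToMove (a b : ℕ) (red blue : Subset (order G)) : Set where
      won   : RedTransversal red → BobToMove a b red blue
      reply : (∀ M → LegalMove b red blue M → AliceToMove a b red (blue ∪ M)) →
              BobToMove a b red blue

  AliceWinsAliceStart : (a b : ℕ) → Set
  AliceWinsAliceStart a b = AliceToMove a b ⊥ ⊥

  -- IsThreshold a says a₁(G) = a.
  IsThreshold : ℕ → Set
  IsThreshold a =
    1 ≤ a × AliceWinsAliceStart a 1 ×
    (∀ a′ → 1 ≤ a′ → AliceWinsAliceStart a′ 1 → a ≤ a′)

{-# OPTIONS --safe #-}

-- In a triangle-free graph without isolated vertices Alice needs a red vertex cover.  Once Bob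
-- colours v, Alice must at once colour every unplayed neighbour of v, so with a moves per turn she
-- wins iff her first a vertices can be chosen so that the remaining graph has maximum degree at
-- most a.  Take G₁ and G₂ with k and ℓ hubs of degree p, the hubs having disjoint closed
-- neighbourhoods.  Fewer than p moves per turn force Alice to start by touching the closed
-- neighbourhood of every hub, whereas p moves suffice to defend an untouched hub; hence
-- a₁(G₁) = k, a₁(G₂) = ℓ and a₁(G₁ ∪ G₂) = min(k + ℓ, p) = p.
module Submission where

open import Defs
open import Data.Bool using (Bool; true; false; if_then_else_)
open import Data.Fin as Fin
  using (Fin; zero; suc; toℕ; fromℕ<; splitAt; join; combine; quotient; remainder; punchIn)
open import Data.Fin.Properties
  using ( toℕ-fromℕ<; toℕ<n; toℕ-injective; injective⇒≤; any?; ¬∀⟶∃¬; splitAt-join; join-splitAt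
        ; toℕ-combine; combine-remQuot; remQuot-combine; combine-injectiveʳ; punchIn-injective )
import Data.Fin.Properties as Fin using (suc-injective)
open import Data.Fin.Subset
  using (Subset; _∈_; _∉_; _⊆_; _∪_; _∩_; _-_; ∁; ∣_∣; ⊥; ⁅_⁆; Nonempty; inside; outside)
open import Data.Fin.Subset.Properties
open import Data.List using (List; []; _∷_; _∷ʳ_)
open import Data.List.Membership.Propositional using () renaming (_∈_ to _∈ˡ_)
open import Data.List.Relation.Unary.All as All using (All; []; _∷_)
open import Data.List.Relation.Unary.All.Properties using (∷ʳ⁻)
open import Data.List.Relation.Unary.AllPairs using ([]; _∷_)
open import Data.List.Relation.Unary.Any using (here; there)
open import Data.List.Relation.Unary.Linked using (Linked; [-]; _∷_)
open import Data.List.Relation.Unary.Unique.Propositional using (Unique)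
open import Data.Nat
  using ( ℕ; zero; suc; pred; _+_; _*_; _∸_; _%_; _≤_; _<_; _⊓_; _⊔_; z≤n; s≤s; s≤s⁻¹
        ; >-nonZero )
open import Data.Nat.DivMod using ([m+kn]%n≡m%n; m≤n⇒m%n≡m)
open import Data.Nat.Properties
open import Data.Product using (Σ-syntax; ∃; _×_; _,_; proj₁; proj₂)
open import Data.Sum as Sum using (_⊎_; inj₁; inj₂; [_,_]′; swap)
open import Data.Sum.Properties using (inj₁-injective; inj₂-injective)
open import Data.Sum.Relation.Binary.Pointwise using (Pointwise; inj₁; inj₂)
open import Data.Unit using (tt) renaming (⊤ to Unit)
open import Data.Vec using ([]; _∷_; tabulate; here; there)
open import Data.Vec.Properties using (lookup∘tabulate; []=⇒lookup; lookup⇒[]=)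
open import Function using (id; _∘_; Injective)
open import Level using (0ℓ)
open import Relation.Binary.Construct.Closure.ReflexiveTransitive using (Star; ε; _◅_; _◅◅_; reverse)
open import Relation.Binary.PropositionalEquality
  using (_≡_; _≢_; refl; sym; trans; cong; cong₂; subst; subst₂)
open import Relation.Nullary using (¬_; Dec; yes; no; contradiction; does; _×-dec_; _⊎-dec_)
open import Relation.Nullary.Decidable using (dec-true; dec-false; decidable-stable; toSum)
open import Relation.Unary using (Pred; Decidable)

-- Counting by injections; subsets of finite sets

private
  variable
    len : ℕ
    A B : Set

-- A labelling by numbers that is bounded and injective on `P` alone counts predicates on any type,
-- and pulls back along injections such as the splitting of a disjoint union.
AtMost : ℕ → Pred A 0ℓ → Set
AtMost {A} s P =
  Σ[ f ∈ (A → ℕ) ] (∀ {x} → P x → f x < s) × (∀ {x y} → P x → P y → f x ≡ f y → x ≡ y)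

AtMost-⊆ : ∀ {s} {P Q : Pred A 0ℓ} → (∀ {x} → P x → Q x) → AtMost s Q → AtMost s P
AtMost-⊆ P⊆Q (f , bounded , inj) = f , bounded ∘ P⊆Q , λ px py → inj (P⊆Q px) (P⊆Q py)

AtMost-∘ : ∀ {s} {Q : Pred B 0ℓ} {g : A → B} → Injective _≡_ _≡_ g → AtMost s Q → AtMost s (Q ∘ g)
AtMost-∘ {g = g} g-inj (f , bounded , inj) = f ∘ g , bounded , λ qx qy → g-inj ∘ inj qx qy

AtMost-≤ : ∀ {s t} {P : Pred A 0ℓ} → s ≤ t → AtMost s P → AtMost t P
AtMost-≤ s≤t (f , bounded , inj) = f , (λ px → ≤-trans (bounded px) s≤t) , inj

AtMost-⊎ : ∀ {A B : Set} {s t} {P : Pred A 0ℓ} {Q : Pred B 0ℓ} →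
  AtMost s P → AtMost t Q → AtMost (s + t) [ P , Q ]′
AtMost-⊎ {A} {B} {s} {t} {P} {Q} (f , f< , f-inj) (g , g< , g-inj) = h , (λ {z} → h< {z}) , h-inj
  where
  h : A ⊎ B → ℕ
  h = [ f , (λ b → s + g b) ]′

  h< : ∀ {z} → [ P , Q ]′ z → h z < s + t
  h< {inj₁ x} px = ≤-trans (f< px) (m≤m+n s t)
  h< {inj₂ y} qy = +-monoʳ-< s (g< qy)

  disjoint : ∀ {x y} → P x → f x ≢ s + g y
  disjoint px eq = <⇒≱ (f< px) (≤-trans (m≤m+n s _) (≤-reflexive (sym eq)))

  h-inj : ∀ {z w} → [ P , Q ]′ z → [ P , Q ]′ w → h z ≡ h w → z ≡ w
  h-inj {inj₁ x} {inj₁ y} px py eq = cong inj₁ (f-inj px py eq)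
  h-inj {inj₂ x} {inj₂ y} qx qy eq = cong inj₂ (g-inj qx qy (+-cancelˡ-≡ s _ _ eq))
  h-inj {inj₁ x} {inj₂ y} px qy eq = contradiction eq (disjoint px)
  h-inj {inj₂ x} {inj₁ y} qx py eq = contradiction (sym eq) (disjoint py)

enumerate : (S : Subset len) →
  Σ[ e ∈ (Fin ∣ S ∣ → Fin len) ] (∀ i → e i ∈ S) × Injective _≡_ _≡_ e
enumerate [] = (λ ()) , (λ ()) , λ {}
enumerate (outside ∷ S) with enumerate S
... | e , e∈S , e-inj = suc ∘ e , there ∘ e∈S , e-inj ∘ Fin.suc-injective
enumerate {suc len} (inside ∷ S) with enumerate S
... | e , e∈S , e-inj = e′ , e′∈S , e′-inj
  where
  e′ : Fin (suc ∣ S ∣) → Fin (suc len)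
  e′ zero    = zero
  e′ (suc i) = suc (e i)

  e′∈S : ∀ i → e′ i ∈ inside ∷ S
  e′∈S zero    = here
  e′∈S (suc i) = there (e∈S i)

  e′-inj : Injective _≡_ _≡_ e′
  e′-inj {zero}  {zero}  _  = refl
  e′-inj {suc i} {suc j} eq = cong suc (e-inj (Fin.suc-injective eq))

AtMost⇒∣S∣≤ : ∀ {s} (S : Subset len) → AtMost s (_∈ S) → ∣ S ∣ ≤ s
AtMost⇒∣S∣≤ {s = s} S (f , bounded , inj) with enumerate S
... | e , e∈S , e-inj = injective⇒≤ {f = f′} λ {i} {j} eq →
    e-inj (inj (e∈S i) (e∈S j) (trans (sym (toℕ-fromℕ< _)) (trans (cong toℕ eq) (toℕ-fromℕ< _))))
  where
  f′ : Fin ∣ S ∣ → Fin s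
  f′ i = fromℕ< (bounded (e∈S i))

injection⇒≤∣S∣ : ∀ {m} (S : Subset len) (g : Fin m → Fin len) →
  Injective _≡_ _≡_ g → (∀ i → g i ∈ S) → m ≤ ∣ S ∣
injection⇒≤∣S∣ {m = zero}  S g g-inj g∈S = z≤n
injection⇒≤∣S∣ {m = suc m} S g g-inj g∈S = ≤-trans (s≤s ih) (x∈p⇒∣p-x∣<∣p∣ (g∈S zero))
  where
  ih : m ≤ ∣ S - g zero ∣
  ih = injection⇒≤∣S∣ (S - g zero) (g ∘ suc) (Fin.suc-injective ∘ g-inj)
    λ i → x∈p∧x≢y⇒x∈p-y (g∈S (suc i)) λ eq → contradiction (g-inj eq) λ ()

x∈p⇒0<∣p∣ : ∀ {x} {S : Subset len} → x ∈ S → 0 < ∣ S ∣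
x∈p⇒0<∣p∣ x∈S = ≤-trans (s≤s z≤n) (x∈p⇒∣p-x∣<∣p∣ x∈S)

0<∣p∣⇒Nonempty : (S : Subset len) → 0 < ∣ S ∣ → Nonempty S
0<∣p∣⇒Nonempty S 0<∣S∣ with enumerate S
... | e , e∈S , _ = _ , e∈S (fromℕ< 0<∣S∣)

∣p∣≤1⇒x≡y : ∀ {x y} {S : Subset len} → ∣ S ∣ ≤ 1 → x ∈ S → y ∈ S → x ≡ y
∣p∣≤1⇒x≡y {x = x} {y} ∣S∣≤1 x∈S y∈S = decidable-stable (x Fin.≟ y) λ x≢y →
  <-irrefl refl (≤-trans (s≤s (x∈p⇒0<∣p∣ (x∈p∧x≢y⇒x∈p-y y∈S (x≢y ∘ sym))))
                         (≤-trans (x∈p⇒∣p-x∣<∣p∣ x∈S) ∣S∣≤1))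

module _ {P : Pred (Fin len) 0ℓ} (P? : Decidable P) where

  fromPred : Subset len
  fromPred = tabulate (does ∘ P?)

  ∈-fromPred⁺ : ∀ {x} → P x → x ∈ fromPred
  ∈-fromPred⁺ {x} px = lookup⇒[]= x _ (trans (lookup∘tabulate _ x) (dec-true (P? x) px))

  ∈-fromPred⁻ : ∀ {x} → x ∈ fromPred → P x
  ∈-fromPred⁻ {x} x∈ with P? x | trans (sym (lookup∘tabulate (does ∘ P?) x)) ([]=⇒lookup x∈)
  ... | yes px | _ = px

-- `LegalMove` prescribes the exact number of coloured vertices, so a set `T` of vertices that
-- matter is padded with further elements of `U`.
extend : ∀ a (T U : Subset len) → T ⊆ U → ∣ T ∣ ≤ a →
  Σ[ M ∈ Subset len ] T ⊆ M × M ⊆ U × ∣ M ∣ ≡ a ⊓ ∣ U ∣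
extend a [] [] _ _ = [] , id , id , sym (⊓-zeroʳ a)
extend a (outside ∷ T) (outside ∷ U) T⊆U ∣T∣≤a with extend a T U (drop-∷-⊆ T⊆U) ∣T∣≤a
... | M , T⊆M , M⊆U , ∣M∣≡ = outside ∷ M , s⊆s T⊆M , s⊆s M⊆U , ∣M∣≡
extend a (inside ∷ T) (outside ∷ U) T⊆U _ with () ← T⊆U here
extend (suc a) (inside ∷ T) (inside ∷ U) T⊆U ∣T∣≤a with extend a T U (drop-∷-⊆ T⊆U) (s≤s⁻¹ ∣T∣≤a)
... | M , T⊆M , M⊆U , ∣M∣≡ = inside ∷ M , s⊆s T⊆M , s⊆s M⊆U , cong suc ∣M∣≡
extend a (outside ∷ T) (inside ∷ U) T⊆U ∣T∣≤a with m≤n⇒m<n∨m≡n ∣T∣≤a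
-- `T` already has `a` elements, so the quota leaves no room for padding.
... | inj₂ refl = outside ∷ T , id , T⊆U , sym (m≤n⇒m⊓n≡m (p⊆q⇒∣p∣≤∣q∣ T⊆U))
... | inj₁ (s≤s ∣T∣≤a′) with extend _ T U (drop-∷-⊆ T⊆U) ∣T∣≤a′
...   | M , T⊆M , M⊆U , ∣M∣≡ = inside ∷ M , out⊆ T⊆M , in⊆in M⊆U , cong suc ∣M∣≡

-- The game on a triangle-free graph

module Game (G : Graph) where
  open Graph G using (Vertex; Adj; adj?; adj-sym; adj-irref; nonempty)

  NoIsolated : Set
  NoIsolated = ∀ v → ∃ λ w → Adj v w

  TriangleFree : Set
  TriangleFree = ∀ {u v w} → Adj u v → Adj v w → ¬ Adj w u

  VertexCover : Subset (Graph.order G) → Set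
  VertexCover S = ∀ {u v} → Adj u v → u ∈ S ⊎ v ∈ S

  singleton-complete : ∀ v → IsComplete G ⁅ v ⁆
  singleton-complete v x∈ y∈ x≢y = contradiction (trans (x∈⁅y⁆⇒x≡y v x∈) (sym (x∈⁅y⁆⇒x≡y v y∈))) x≢y

  edge-complete : ∀ {u v} → Adj u v → IsComplete G (⁅ u ⁆ ∪ ⁅ v ⁆)
  edge-complete {u} {v} uv x∈ y∈ x≢y with x∈p∪q⁻ ⁅ u ⁆ ⁅ v ⁆ x∈ | x∈p∪q⁻ ⁅ u ⁆ ⁅ v ⁆ y∈
  ... | inj₁ x∈u | inj₁ y∈u = singleton-complete u x∈u y∈u x≢y
  ... | inj₂ x∈v | inj₂ y∈v = singleton-complete v x∈v y∈v x≢y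
  ... | inj₁ x∈u | inj₂ y∈v rewrite x∈⁅y⁆⇒x≡y u x∈u | x∈⁅y⁆⇒x≡y v y∈v = uv
  ... | inj₂ x∈v | inj₁ y∈u rewrite x∈⁅y⁆⇒x≡y v x∈v | x∈⁅y⁆⇒x≡y u y∈u = adj-sym uv

  clique-nonempty : ∀ {K} → IsClique G K → Nonempty K
  clique-nonempty {K} (_ , maximal) with nonempty? K
  ... | yes ne = ne
  ... | no empty =
      v , maximal ⁅ v ⁆ (singleton-complete v) (λ x∈K → contradiction (_ , x∈K) empty) (x∈⁅x⁆ v)
    where v = fromℕ< nonempty

  -- A clique avoiding a red cover contains no edge, so it is a single vertex `u`; but the edge from
  -- `u` to a neighbour is then a larger complete set, against maximality.
  cover⇒transversal : NoIsolated → ∀ {red} → VertexCover red → RedTransversal G red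
  cover⇒transversal neighbour {red} cover K clique@(complete , maximal)
    with u , u∈K ← clique-nonempty clique
    with nonempty? (K ∩ red)
  ... | yes ne = ne
  ... | no disjoint = contradiction (w , x∈p∩q⁺ (w∈K , w∈red)) disjoint
    where
    w  = proj₁ (neighbour u)
    uw = proj₂ (neighbour u)

    u∉red : u ∉ red
    u∉red u∈red = disjoint (u , x∈p∩q⁺ (u∈K , u∈red))

    w∈red : w ∈ red
    w∈red = [ (λ u∈red → contradiction u∈red u∉red) , id ]′ (cover uw)

    K≡u : ∀ {x} → x ∈ K → x ≡ u
    K≡u {x} x∈K = decidable-stable (x Fin.≟ u) λ x≢u →
      [ u∉red , (λ x∈red → disjoint (x , x∈p∩q⁺ (x∈K , x∈red))) ]′
        (cover (complete u∈K x∈K (x≢u ∘ sym)))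

    w∈K : w ∈ K
    w∈K = maximal _ (edge-complete uw)
            (λ x∈K → x∈p∪q⁺ (inj₁ (subst (_∈ ⁅ u ⁆) (sym (K≡u x∈K)) (x∈⁅x⁆ u))))
            (x∈p∪q⁺ (inj₂ (x∈⁅x⁆ w)))

  edge-clique : TriangleFree → ∀ {u v} → Adj u v → IsClique G (⁅ u ⁆ ∪ ⁅ v ⁆)
  edge-clique no-triangle {u} {v} uv = edge-complete uv , maximal
    where
    maximal : ∀ T → IsComplete G T → ⁅ u ⁆ ∪ ⁅ v ⁆ ⊆ T → T ⊆ ⁅ u ⁆ ∪ ⁅ v ⁆
    maximal T complete e⊆T {x} x∈T with x Fin.≟ u | x Fin.≟ v
    ... | yes refl | _        = x∈p∪q⁺ (inj₁ (x∈⁅x⁆ x))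
    ... | no _     | yes refl = x∈p∪q⁺ (inj₂ (x∈⁅x⁆ x))
    ... | no x≢u   | no x≢v   = contradiction (complete x∈T (e⊆T (x∈p∪q⁺ (inj₁ (x∈⁅x⁆ u)))) x≢u)
            (no-triangle uv (complete (e⊆T (x∈p∪q⁺ (inj₂ (x∈⁅x⁆ v)))) x∈T (x≢v ∘ sym)))

  uncovered⇒¬transversal : TriangleFree → ∀ {u v red} → Adj u v → u ∉ red → v ∉ red →
                           ¬ RedTransversal G red
  uncovered⇒¬transversal no-triangle {u} {v} {red} uv u∉red v∉red transversal
    with transversal _ (edge-clique no-triangle uv)
  ... | x , x∈ with x∈p∩q⁻ (⁅ u ⁆ ∪ ⁅ v ⁆) red x∈
  ...   | x∈e , x∈red with x∈p∪q⁻ ⁅ u ⁆ ⁅ v ⁆ x∈e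
  ...     | inj₁ x∈u = u∉red (subst (_∈ red) (x∈⁅y⁆⇒x≡y u x∈u) x∈red)
  ...     | inj₂ x∈v = v∉red (subst (_∈ red) (x∈⁅y⁆⇒x≡y v x∈v) x∈red)

  module _ {P : Pred (Fin (Graph.order G)) 0ℓ} (P? : Decidable P) (neighbour : NoIsolated)
           {a : ℕ} (degree≤a : ∀ v → ¬ P v → AtMost a (λ w → Adj v w × ¬ P w)) where

    -- Invariant on Bob's turns: `P` is red, and so are all neighbours of blue vertices. Bob's
    -- vertex `x` lies outside `P`, so it has at most `a` non-red neighbours, and Alice colours them
    -- all. The number of unplayed vertices, bounded by `fuel`, shrinks each round; on a full board
    -- the invariant makes red a vertex cover.
    defend : ∀ fuel {red blue} → ∣ ∁ (red ∪ blue) ∣ ≤ fuel → (∀ {x} → P x → x ∈ red) →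
             (∀ {u v} → u ∈ blue → Adj u v → v ∈ red) → BobToMove G a 1 red blue
    defend fuel {red} {blue} ∣U∣≤fuel P⊆red safe with nonempty? (∁ (red ∪ blue))
    ... | no full = won (cover⇒transversal neighbour cover)
      where
      cover : VertexCover red
      cover {u} {v} uv with x∈p∪q⁻ red blue (x∉∁p⇒x∈p λ u∈U → full (u , u∈U))
      ... | inj₁ u∈red  = inj₁ u∈red
      ... | inj₂ u∈blue = inj₂ (safe u∈blue uv)
    defend zero ∣U∣≤fuel _ _ | yes (x , x∈U) =
      contradiction (≤-trans (x∈p⇒0<∣p∣ x∈U) ∣U∣≤fuel) λ ()
    defend (suc fuel) {red} {blue} ∣U∣≤fuel P⊆red safe | yes (_ , z∈U) = reply answer
      where
      answer : ∀ M → LegalMove G 1 red blue M → AliceToMove G a 1 red (blue ∪ M)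
      answer M (M⊆U , ∣M∣≡)
        with 0<∣p∣⇒Nonempty M (≤-reflexive (trans (sym (m≤n⇒m⊓n≡m (x∈p⇒0<∣p∣ z∈U))) (sym ∣M∣≡)))
      ... | x , x∈M = move N (N⊆U′ , ∣N∣≡)
              (defend fuel (s≤s⁻¹ (≤-trans (s≤s (p⊆q⇒∣p∣≤∣q∣ U″⊆U′)) (≤-trans ∣U′∣<∣U∣ ∣U∣≤fuel)))
                (λ px → p⊆p∪q N (P⊆red px)) safe′)
        where
        U′ : Subset (Graph.order G)
        U′ = ∁ (red ∪ (blue ∪ M))

        x∉red : x ∉ red
        x∉red x∈red = x∈∁p⇒x∉p (M⊆U x∈M) (p⊆p∪q blue x∈red)

        threatened? : Decidable (λ w → w ∈ U′ × Adj x w)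
        threatened? w = (w ∈? U′) ×-dec adj? x w

        ∉red : ∀ {w} → w ∈ U′ → w ∉ red
        ∉red w∈U′ w∈red = x∈∁p⇒x∉p w∈U′ (p⊆p∪q (blue ∪ M) w∈red)

        extension = extend a (fromPred threatened?) U′ (proj₁ ∘ ∈-fromPred⁻ threatened?)
          (AtMost⇒∣S∣≤ _ (AtMost-⊆
            (λ w∈ → let (w∈U′ , xw) = ∈-fromPred⁻ threatened? w∈ in xw , ∉red w∈U′ ∘ P⊆red)
            (degree≤a x (x∉red ∘ P⊆red))))
        N    = proj₁ extension
        T⊆N  = proj₁ (proj₂ extension)
        N⊆U′ : N ⊆ U′
        N⊆U′ = proj₁ (proj₂ (proj₂ extension))
        ∣N∣≡ = proj₂ (proj₂ (proj₂ extension))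

        U′⊆U : U′ ⊆ ∁ (red ∪ blue)
        U′⊆U = p⊆q⇒∁p⊇∁q λ y∈ → [ (λ y∈red → p⊆p∪q (blue ∪ M) y∈red)
          , (λ y∈blue → q⊆p∪q red _ (p⊆p∪q M y∈blue)) ]′ (x∈p∪q⁻ red blue y∈)

        ∣U′∣<∣U∣ : ∣ U′ ∣ < ∣ ∁ (red ∪ blue) ∣
        ∣U′∣<∣U∣ = p⊂q⇒∣p∣<∣q∣ (U′⊆U , x , M⊆U x∈M ,
          λ x∈U′ → x∈∁p⇒x∉p x∈U′ (q⊆p∪q red _ (q⊆p∪q blue M x∈M)))

        ∣M∣≤1 : ∣ M ∣ ≤ 1
        ∣M∣≤1 = ≤-trans (≤-reflexive ∣M∣≡) (m⊓n≤m 1 _)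

        U″⊆U′ : ∁ ((red ∪ N) ∪ (blue ∪ M)) ⊆ U′
        U″⊆U′ = p⊆q⇒∁p⊇∁q λ y∈ → [ (λ y∈red → p⊆p∪q _ (p⊆p∪q N y∈red)) , q⊆p∪q (red ∪ N) _ ]′
          (x∈p∪q⁻ red (blue ∪ M) y∈)

        safe′ : ∀ {u v} → u ∈ blue ∪ M → Adj u v → v ∈ red ∪ N
        safe′ {u} {v} u∈ uv with x∈p∪q⁻ blue M u∈ | v ∈? U′
        ... | inj₁ u∈blue | _ = p⊆p∪q N (safe u∈blue uv)
        ... | inj₂ u∈M | v∈?U′ with refl ← ∣p∣≤1⇒x≡y ∣M∣≤1 u∈M x∈M | v∈?U′
        ...   | yes v∈U′ = q⊆p∪q red N (T⊆N (∈-fromPred⁺ threatened? (v∈U′ , uv)))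
        ...   | no v∉U′ with x∈p∪q⁻ red _ (x∉∁p⇒x∈p v∉U′)
        ...     | inj₁ v∈red = p⊆p∪q N v∈red
        ...     | inj₂ v∈ with x∈p∪q⁻ blue M v∈
        -- If `v` was blue before this round, the invariant had already made its neighbour `x` red.
        ...       | inj₁ v∈blue = contradiction (safe v∈blue (adj-sym uv)) x∉red
        ...       | inj₂ v∈M with refl ← ∣p∣≤1⇒x≡y ∣M∣≤1 u∈M v∈M
                    = contradiction uv adj-irref

    -- Alice opens with `P`, padded to a legal move; as no vertex is blue yet, the invariant of
    -- `defend` holds.
    deletion⇒aliceWins : AtMost a P → AliceWinsAliceStart G a 1
    deletion⇒aliceWins P≤a
      with extend a (fromPred P?) (∁ (⊥ ∪ ⊥)) (λ _ → x∉p⇒x∈∁p ([ ∉⊥ , ∉⊥ ]′ ∘ x∈p∪q⁻ ⊥ ⊥))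
             (AtMost⇒∣S∣≤ _ (AtMost-⊆ (∈-fromPred⁻ P?) P≤a))
    ... | M , P⊆M , M⊆U , ∣M∣≡ = move M (M⊆U , ∣M∣≡)
            (defend _ ≤-refl (λ px → q⊆p∪q ⊥ M (P⊆M (∈-fromPred⁺ P? px)))
              (λ u∈⊥ → contradiction u∈⊥ ∉⊥))

  -- A certificate for lower bounds. The function `zone` encodes that the stars are pairwise
  -- disjoint, in a form ready for the pigeonhole principle.
  record Stars (m D : ℕ) : Set where
    field
      hub       : Fin m → Vertex
      leaf      : Fin m → Fin D → Vertex
      adjacent  : ∀ i j → Adj (hub i) (leaf i j)
      leaf-inj  : ∀ i → Injective _≡_ _≡_ (leaf i)
      zone      : Vertex → Fin m
      zone-hub  : ∀ i → zone (hub i) ≡ i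
      zone-leaf : ∀ i j → zone (leaf i j) ≡ i

  module _ (no-triangle : TriangleFree) {a : ℕ} where

    ¬red-after-move : ∀ {u red blue M} → u ∈ blue → u ∉ red → LegalMove G a red blue M →
                      u ∉ red ∪ M
    ¬red-after-move {red = red} {blue} {M} u∈blue u∉red (M⊆U , _) u∈ with x∈p∪q⁻ red M u∈
    ... | inj₁ u∈red = u∉red u∈red
    ... | inj₂ u∈M   = x∈∁p⇒x∉p (M⊆U u∈M) (q⊆p∪q red blue u∈blue)

    -- A blue edge can never be covered, but a strategy tree need not end at once; the play is
    -- followed by induction on the tree until it claims a transversal.
    bob-has-won : ∀ {u v red blue} → Adj u v → u ∈ blue → v ∈ blue → u ∉ red → v ∉ red →
                  ¬ AliceToMove G a 1 red blue
    bob-has-won uv _ _ u∉red v∉red (won t) = uncovered⇒¬transversal no-triangle uv u∉red v∉red t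
    bob-has-won uv u∈blue v∈blue u∉red v∉red (move M legal (won t)) =
      uncovered⇒¬transversal no-triangle uv
        (¬red-after-move u∈blue u∉red legal) (¬red-after-move v∈blue v∉red legal) t
    bob-has-won {red = red} {blue} uv u∈blue v∈blue u∉red v∉red (move M legal (reply respond))
      -- Any legal move serves Bob here; on a full board it is the empty one.
      with extend 1 ⊥ (∁ ((red ∪ M) ∪ blue)) (λ x∈⊥ → contradiction x∈⊥ ∉⊥)
             (≤-trans (≤-reflexive (∣⊥∣≡0 (Graph.order G))) z≤n)
    ... | B , _ , B⊆U , ∣B∣≡ = bob-has-won uv (p⊆p∪q B u∈blue) (p⊆p∪q B v∈blue)
            (¬red-after-move u∈blue u∉red legal) (¬red-after-move v∈blue v∉red legal)
            (respond B (B⊆U , ∣B∣≡))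

    bob-plays : ∀ {x red blue} → x ∉ red → x ∉ blue → LegalMove G 1 red blue ⁅ x ⁆
    bob-plays {x} {red} {blue} x∉red x∉blue =
      (λ y∈ → subst (_∈ ∁ (red ∪ blue)) (sym (x∈⁅y⁆⇒x≡y x y∈)) x∈U) ,
      trans (∣⁅x⁆∣≡1 x) (sym (m≤n⇒m⊓n≡m (x∈p⇒0<∣p∣ x∈U)))
      where
      x∈U : x ∈ ∁ (red ∪ blue)
      x∈U = x∉p⇒x∈∁p λ x∈ → [ x∉red , x∉blue ]′ (x∈p∪q⁻ red blue x∈)

    bob-attacks-leaf : ∀ {u v red blue} → Adj u v → u ∈ blue → u ∉ red → v ∉ red → v ∉ blue →
                       ¬ BobToMove G a 1 red blue
    bob-attacks-leaf uv u∈blue u∉red v∉red v∉blue (won t) =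
      uncovered⇒¬transversal no-triangle uv u∉red v∉red t
    bob-attacks-leaf {u} {v} {red} {blue} uv u∈blue u∉red v∉red v∉blue (reply respond) =
      bob-has-won uv (p⊆p∪q ⁅ v ⁆ u∈blue) (q⊆p∪q blue ⁅ v ⁆ (x∈⁅x⁆ v)) u∉red v∉red
        (respond ⁅ v ⁆ (bob-plays v∉red v∉blue))

    module _ {D : ℕ} (a<D : a < D) {u : Vertex} {leaf : Fin D → Vertex}
             (leaf-inj : Injective _≡_ _≡_ leaf) (adjacent : ∀ j → Adj u (leaf j)) where

      private
        leaf∉u : ∀ j → leaf j ∉ ⊥ ∪ ⁅ u ⁆
        leaf∉u j l∈ =
          [ ∉⊥ , (λ l∈u → adj-irref (subst (Adj u) (x∈⁅y⁆⇒x≡y u l∈u) (adjacent j))) ]′ (x∈p∪q⁻ ⊥ ⁅ u ⁆ l∈)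

        someLeaf : Fin D
        someLeaf = fromℕ< (≤-trans (s≤s z≤n) a<D)

      -- Bob takes the centre `u`. Alice's answer colours at most `a < D` vertices, so some leaf
      -- stays unplayed, and by taking it Bob completes a blue edge.
      bob-attacks-star : ∀ {red} → u ∉ red → (∀ j → leaf j ∉ red) → ¬ BobToMove G a 1 red ⊥
      bob-attacks-star u∉red leaf∉red (won t) =
        uncovered⇒¬transversal no-triangle (adjacent someLeaf) u∉red (leaf∉red _) t
      bob-attacks-star {red} u∉red leaf∉red (reply respond) with respond ⁅ u ⁆ (bob-plays u∉red ∉⊥)
      ... | won t = uncovered⇒¬transversal no-triangle (adjacent someLeaf) u∉red (leaf∉red _) t
      ... | move M legal@(_ , ∣M∣≡) bob
              with ¬∀⟶∃¬ D (λ j → leaf j ∈ M) (λ j → leaf j ∈? M) (λ leaf∈M →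
                <-irrefl refl (≤-trans a<D (≤-trans (injection⇒≤∣S∣ M leaf leaf-inj leaf∈M)
                  (≤-trans (≤-reflexive ∣M∣≡) (m⊓n≤m a _)))))
      ...   | j , l∉M = bob-attacks-leaf (adjacent j) u∈blue (¬red-after-move u∈blue u∉red legal)
                ([ leaf∉red j , l∉M ]′ ∘ x∈p∪q⁻ red M) (leaf∉u j) bob
        where u∈blue = q⊆p∪q ⊥ ⁅ u ⁆ (x∈⁅x⁆ u)

    stars⇒¬aliceWins : ∀ {m D} → Stars m D → a < m → a < D → ¬ AliceWinsAliceStart G a 1
    stars⇒¬aliceWins stars a<m a<D (won t) = uncovered⇒¬transversal no-triangle
        (adjacent (fromℕ< (≤-trans (s≤s z≤n) a<m)) (fromℕ< (≤-trans (s≤s z≤n) a<D))) ∉⊥ ∉⊥ t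
      where open Stars stars
    stars⇒¬aliceWins {m} {D} stars a<m a<D (move M (_ , ∣M∣≡) bob) =
        bob-attacks-star a<D (leaf-inj i) (adjacent i)
          (untouched (zone-hub i)) (λ j → untouched (zone-leaf i j)) bob
      where
      open Stars stars

      Touched : Fin m → Set
      Touched i = ∃ λ v → v ∈ M × zone v ≡ i

      -- Pigeonhole: one coloured vertex chosen in each zone would give `m` members of `M`, distinct
      -- because `zone` separates them.
      free : ∃ λ i → ¬ Touched i
      free = ¬∀⟶∃¬ m Touched (λ i → any? λ v → (v ∈? M) ×-dec (zone v Fin.≟ i)) λ touched →
        <-irrefl refl (≤-trans a<m (≤-trans
          (injection⇒≤∣S∣ M (proj₁ ∘ touched)
            (λ {i} {j} eq → trans (sym (proj₂ (proj₂ (touched i))))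
              (trans (cong zone eq) (proj₂ (proj₂ (touched j)))))
            (λ i → proj₁ (proj₂ (touched i))))
          (≤-trans (≤-reflexive ∣M∣≡) (m⊓n≤m a _))))

      i = proj₁ free

      untouched : ∀ {v} → zone v ≡ i → v ∉ ⊥ ∪ M
      untouched zv≡i v∈ = [ ∉⊥ , (λ v∈M → proj₂ free (_ , v∈M , zv≡i)) ]′ (x∈p∪q⁻ ⊥ M v∈)

-- Caterpillars given by parent functions

triangle-free : ∀ G → Acyclic G → Game.TriangleFree G
triangle-free G acyclic {u} {v} {w} uv vw wu = acyclic u (v ∷ w ∷ [])
  ( s≤s (s≤s z≤n)
  , ((≢-edge uv ∷ (λ u≡w → ≢-edge wu (sym u≡w)) ∷ []) ∷ (≢-edge vw ∷ []) ∷ [] ∷ [])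
  , (uv ∷ vw ∷ wu ∷ [-]))
  where
  open Graph G
  ≢-edge : ∀ {x y} → Adj x y → x ≢ y
  ≢-edge xy refl = adj-irref xy

-- Numbering a caterpillar breadth-first, the parent of a vertex is the last spine vertex before
-- it; conversely, every choice of spine vertices yields a caterpillar in this way.
module Caterpillar (internal : ℕ → Bool) where

  parent : ℕ → ℕ
  parent zero    = zero
  parent (suc v) = if internal v then v else parent v

  infix 4 _◁_
  -- The conjunct `u < v` excludes `v = 0`: the root has no parent, and the value `parent zero` is a
  -- dummy.
  _◁_ : ℕ → ℕ → Set
  u ◁ v = u < v × parent v ≡ u

  parent-suc-≤ : ∀ v → parent (suc v) ≤ v
  parent-suc-≤ zero with internal zero
  ... | true  = z≤n
  ... | false = z≤n
  parent-suc-≤ (suc v) with internal (suc v)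
  ... | true  = ≤-refl
  ... | false = m≤n⇒m≤1+n (parent-suc-≤ v)

  parent-◁ : ∀ {v} → 0 < v → parent v ◁ v
  parent-◁ {suc v} _ = s≤s (parent-suc-≤ v) , refl

  -- If the search for a spine vertex backwards from `w` ends below `v`, it has met none from `v`
  -- on, so it passes `v` and continues as the search from `v`.
  parent-const : ∀ {v w} → parent w < v → v ≤ w → parent v ≡ parent w
  parent-const {v} {zero}  () z≤n
  parent-const {v} {suc w} p<v v≤ with m≤n⇒m<n∨m≡n v≤
  ... | inj₂ refl = refl
  ... | inj₁ (s≤s v≤w) with internal w
  ...   | true  = contradiction v≤w (<⇒≱ p<v)
  ...   | false = parent-const p<v v≤w

  module _ (N : ℕ) (0<N : 0 < N) where

    graph : Graph
    graph = record
      { order     = N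
      ; nonempty  = 0<N
      ; Adj       = λ u v → toℕ u ◁ toℕ v ⊎ toℕ v ◁ toℕ u
      ; adj?      = λ u v → ◁? (toℕ u) (toℕ v) ⊎-dec ◁? (toℕ v) (toℕ u)
      ; adj-sym   = swap
      ; adj-irref = [ <-irrefl refl ∘ proj₁ , <-irrefl refl ∘ proj₁ ]′
      }
      where
      ◁? : ∀ u v → Dec (u ◁ v)
      ◁? u v = (u <? v) ×-dec (parent v ≟ u)

    open Graph graph using (Adj; Vertex; adj-sym)

    parentOf : (v : Vertex) → 0 < toℕ v → Σ[ u ∈ Vertex ] toℕ u ◁ toℕ v
    parentOf v 0<v = fromℕ< p<N , subst (_◁ toℕ v) (sym (toℕ-fromℕ< p<N)) (parent-◁ 0<v)
      where
      p<N : parent (toℕ v) < N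
      p<N = <-trans (proj₁ (parent-◁ 0<v)) (toℕ<n v)

    root : Vertex
    root = fromℕ< 0<N

    ◁-unique : ∀ {u v w} → u ◁ w → v ◁ w → u ≡ v
    ◁-unique (_ , p≡u) (_ , p≡v) = trans (sym p≡u) p≡v

    toRoot : ∀ fuel (v : Vertex) → toℕ v ≤ fuel → Star Adj v root
    toRoot fuel v v≤ with toℕ v in eq
    ... | zero rewrite toℕ-injective {i = v} {j = root} (trans eq (sym (toℕ-fromℕ< 0<N))) = ε
    toRoot (suc fuel) v (s≤s v≤) | suc v′ with parentOf v (subst (0 <_) (sym eq) (s≤s z≤n))
    ...   | u , u◁v = inj₂ u◁v ◅ toRoot fuel u (≤-trans (s≤s⁻¹ (subst (toℕ u <_) eq (proj₁ u◁v))) v≤)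

    connected : Connected graph
    connected u v = toRoot _ u ≤-refl ◅◅ reverse adj-sym (toRoot _ v ≤-refl)

    -- The closed walk of a cycle is not `Unique`, as it returns to its start; this weaker local
    -- condition survives and passes to tails.
    NonBacktracking : List Vertex → Set
    NonBacktracking (x ∷ y ∷ z ∷ l) = x ≢ z × NonBacktracking (y ∷ z ∷ l)
    NonBacktracking _               = Unit

    unique⇒nonBacktracking : ∀ {l w} → Unique l → All (_≢ w) l → NonBacktracking (l ∷ʳ w)
    unique⇒nonBacktracking {[]} _ _ = tt
    unique⇒nonBacktracking {x ∷ []} _ _ = tt
    unique⇒nonBacktracking {x ∷ y ∷ []} _ (x≢w ∷ _) = x≢w , tt
    unique⇒nonBacktracking {x ∷ y ∷ z ∷ l} ((_ ∷ x≢z ∷ _) ∷ unique) (_ ∷ ≢w) =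
      x≢z , unique⇒nonBacktracking unique ≢w

    -- A non-backtracking walk that has once gone from a parent to a child never turns back.
    ascend : ∀ {u x l} → toℕ u ◁ toℕ x → Linked Adj (x ∷ l) → NonBacktracking (u ∷ x ∷ l) →
             All (λ y → toℕ x ≤ toℕ y) l
    ascend u◁x [-] _ = []
    ascend u◁x (inj₂ y◁x ∷ _) (u≢y , _) = contradiction (toℕ-injective (◁-unique u◁x y◁x)) u≢y
    ascend u◁x (inj₁ x◁y ∷ walk) (_ , nb) =
      <⇒≤ (proj₁ x◁y) ∷ All.map (≤-trans (<⇒≤ (proj₁ x◁y))) (ascend x◁y walk nb)

    last-All : ∀ {P : Vertex → Set} l {w} → All P (l ∷ʳ w) → P w
    last-All l = proj₂ ∘ ∷ʳ⁻

    -- A non-backtracking walk first descends and then ascends. If its last step ascends, it comes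
    -- from the parent of `w`; otherwise the whole walk descends.
    ascend-or-descend : ∀ {x l w} → Linked Adj (x ∷ l ∷ʳ w) → NonBacktracking (x ∷ l ∷ʳ w) →
      (Σ[ z ∈ Vertex ] z ∈ˡ x ∷ l × toℕ z ◁ toℕ w) ⊎ toℕ w < toℕ x
    ascend-or-descend {l = []} (inj₁ x◁w ∷ _) _ = inj₁ (_ , here refl , x◁w)
    ascend-or-descend {l = []} (inj₂ w◁x ∷ _) _ = inj₂ (proj₁ w◁x)
    ascend-or-descend {x} {y ∷ l} (xy ∷ walk) nb with ascend-or-descend walk (tail-nb l nb)
      where
      tail-nb : ∀ l {w} → NonBacktracking (x ∷ y ∷ l ∷ʳ w) → NonBacktracking (y ∷ l ∷ʳ w)
      tail-nb []      = proj₂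
      tail-nb (_ ∷ _) = proj₂
    ascend-or-descend {x} {y ∷ l} _ _ | inj₁ (z , z∈ , z◁w) = inj₁ (z , there z∈ , z◁w)
    ascend-or-descend {x} {y ∷ l} (inj₂ y◁x ∷ _) _ | inj₂ w<y = inj₂ (<-trans w<y (proj₁ y◁x))
    ascend-or-descend {x} {y ∷ l} (inj₁ x◁y ∷ walk) nb | inj₂ w<y =
      contradiction w<y (≤⇒≯ (last-All l (ascend x◁y walk nb)))

    -- After a first step up from `v` the walk cannot come back down to `v`. If the first step goes
    -- down to the parent `x`, the walk cannot return through `x` again, so it descends from `y` to
    -- `v`. An upward step from `x` to `y` forbids this by `ascend`; a downward one puts `y` below
    -- `v`.
    acyclic : Acyclic graph
    acyclic v (_ ∷ []) (s≤s () , _)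
    acyclic v (x ∷ y ∷ l)
      (_ , (≢v@(_ ∷ v≢y ∷ _) ∷ unique@(≢x ∷ unique′)) , (step ∷ walk@(xy ∷ walk′))) = go step xy
      where
      nb′ : NonBacktracking (x ∷ y ∷ l ∷ʳ v)
      nb′ = unique⇒nonBacktracking unique (All.map (λ v≢ eq → v≢ (sym eq)) ≢v)

      nb : NonBacktracking (v ∷ x ∷ y ∷ l ∷ʳ v)
      nb = v≢y , nb′

      nb″ : NonBacktracking (y ∷ l ∷ʳ v)
      nb″ = unique⇒nonBacktracking unique′ (All.map (λ v≢ eq → v≢ (sym eq)) (All.tail ≢v))

      go : Adj v x → Adj x y → _
      go (inj₁ v◁x) _ = <⇒≱ (proj₁ v◁x) (last-All (y ∷ l) (ascend v◁x walk nb))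
      go (inj₂ x◁v) xy with ascend-or-descend walk′ nb″
      ... | inj₁ (z , z∈ , z◁v) = All.lookup ≢x z∈ (toℕ-injective (◁-unique x◁v z◁v))
      go (inj₂ x◁v) (inj₁ x◁y) | inj₂ v<y = <⇒≱ v<y (last-All l (ascend x◁y walk′ nb′))
      go (inj₂ x◁v) (inj₂ y◁x) | inj₂ v<y = <-asym v<y (<-trans (proj₁ y◁x) (proj₁ x◁v))

    -- By parent-const the ancestors of w include the parent of every vertex up to w, so the path
    -- from the last vertex to the root meets every edge.
    Spine : Vertex → List Vertex → Set
    Spine w l = Linked Adj (w ∷ l) × All (λ y → toℕ y < toℕ w) l × Unique l ×
      (∀ {u v : Vertex} → toℕ v ≤ toℕ w → toℕ u ◁ toℕ v → u ∈ˡ w ∷ l)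

    spine : ∀ fuel w → toℕ w ≤ fuel → ∃ (Spine w)
    spine fuel w w≤ with toℕ w in eq
    ... | zero = [] , [-] , [] , [] , λ v≤0 (u<v , _) → contradiction (≤-trans u<v v≤0) λ ()
    spine (suc fuel) w (s≤s w≤) | suc w′ with parentOf w (subst (0 <_) (sym eq) (s≤s z≤n))
    ...   | p , p◁w@(p<w , pw≡p) with spine fuel p (≤-trans (s≤s⁻¹ (subst (toℕ p <_) eq p<w)) w≤)
    ...     | l , path , below , unique , covers =
      p ∷ l , inj₂ p◁w ∷ path ,
      subst (toℕ p <_) eq p<w ∷ All.map (λ y<p → <-trans y<p (subst (toℕ p <_) eq p<w)) below ,
      All.map (λ y<p p≡y → <-irrefl (cong toℕ (sym p≡y)) y<p) below ∷ unique , covers′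
      where
      covers′ : ∀ {u v} → toℕ v ≤ suc w′ → toℕ u ◁ toℕ v → u ∈ˡ w ∷ p ∷ l
      covers′ {u} {v} v≤w u◁v with toℕ v ≤? toℕ p
      ... | yes v≤p = there (covers v≤p u◁v)
      ... | no v≰p  = there (here (toℕ-injective (trans (sym (proj₂ u◁v))
              (trans (parent-const (subst (_< toℕ v) (sym pw≡p) (≰⇒> v≰p))
                (subst (toℕ v ≤_) (sym eq) v≤w)) pw≡p))))

    pred<N : pred N < N
    pred<N = ≤-reflexive (suc-pred N {{>-nonZero 0<N}})

    isCaterpillar : IsCaterpillar graph
    isCaterpillar with spine _ (fromℕ< pred<N) ≤-refl
    ... | l , path , below , unique , covers = (connected , acyclic) , _ ∷ l ,
        ((λ ()) , path , All.map (λ y<w w≡y → <-irrefl (cong toℕ (sym w≡y)) y<w) below ∷ unique) ,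
        λ { u v (inj₁ u◁v) → inj₁ (covers (≤last v) u◁v)
          ; u v (inj₂ v◁u) → inj₂ (covers (≤last u) v◁u)
          }
      where
      ≤last : ∀ v → toℕ v ≤ toℕ (fromℕ< pred<N)
      ≤last v = ≤-trans (<⇒≤pred (toℕ<n v)) (≤-reflexive (sym (toℕ-fromℕ< pred<N)))

-- Hubs of degree D

-- Vertex c * i + j is the j-th vertex of zone i: its hub is j = 1, whose neighbours are the other
-- D vertices of the zone, and the vertex j = D is joined to the vertex 0 of zone i + 1.  For D = 1
-- the hub itself is that last vertex, so hubs have degree at most D only under n ≤ D.
module Comb (n′ e : ℕ) where

  n D c : ℕ
  n = suc n′
  D = suc e
  c = suc D

  -- Position 0 is the parent of the hub, position 1 of the positions 2 to `D`, and position `D` of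
  -- the start of the next zone.
  onSpine : ℕ → Bool
  onSpine zero       = true
  onSpine (suc zero) = true
  onSpine j          = does (j ≟ D)

  open Caterpillar (λ v → onSpine (v % c)) using (parent; _◁_; graph; acyclic; isCaterpillar)

  private
    position : ∀ i {j} → j ≤ D → (c * i + j) % c ≡ j
    position i {j} j≤D rewrite +-comm (c * i) j | *-comm c i =
      trans ([m+kn]%n≡m%n j i c) (m≤n⇒m%n≡m j≤D)

  parent-spine : ∀ i {j} → j ≤ D → onSpine j ≡ true → parent (c * i + suc j) ≡ c * i + j
  parent-spine i {j} j≤D spine rewrite +-suc (c * i) j | position i j≤D | spine = refl

  parent-leaf : ∀ i {j} → suc (suc j) ≤ D → parent (c * i + suc (suc j)) ≡ c * i + 1
  parent-leaf i {zero}  2≤D = parent-spine i (<⇒≤ 2≤D) refl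
  parent-leaf i {suc j} 3+j≤D
    rewrite +-suc (c * i) (suc (suc j)) | position i (<⇒≤ 3+j≤D)
          | dec-false (suc (suc j) ≟ D) (<⇒≢ 3+j≤D)
    = parent-leaf i (<⇒≤ 3+j≤D)

  parent-first : ∀ i → parent (c * suc i + 0) ≡ c * i + D
  parent-first i = trans (cong parent eq) (parent-spine i ≤-refl (onSpine-D refl))
    where
    eq : c * suc i + 0 ≡ c * i + suc D
    eq = trans (+-identityʳ _) (trans (*-suc c i) (+-comm c (c * i)))
    -- A variable in place of `D` lets `onSpine` compute; the clause for 1 is the case `D = 1`,
    -- where the link starts at the hub.
    onSpine-D : ∀ {j} → j ≡ D → onSpine j ≡ true
    onSpine-D {zero}        _   = refl
    onSpine-D {suc zero}    _   = refl
    onSpine-D {suc (suc j)} j≡D = dec-true (suc (suc j) ≟ D) j≡D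

  comb : Graph
  comb = graph (n * c) (s≤s z≤n)

  comb-isCaterpillar : IsCaterpillar comb
  comb-isCaterpillar = isCaterpillar (n * c) (s≤s z≤n)

  comb-triangle-free : Game.TriangleFree comb
  comb-triangle-free = triangle-free comb (acyclic (n * c) (s≤s z≤n))

  open Graph comb using (Vertex; Adj; adj-sym)

  zone : Vertex → Fin n
  zone = quotient c

  pos : Vertex → ℕ
  pos v = toℕ (remainder {n} c v)

  pos≤D : ∀ v → pos v ≤ D
  pos≤D v = s≤s⁻¹ (toℕ<n (remainder {n} c v))

  toℕ-vertex : ∀ v → toℕ v ≡ c * toℕ (zone v) + pos v
  toℕ-vertex v =
    trans (cong toℕ (sym (combine-remQuot {n} c v))) (toℕ-combine (zone v) (remainder {n} c v))

  vertex-ext : ∀ {v w} → zone v ≡ zone w → pos v ≡ pos w → v ≡ w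
  vertex-ext {v} {w} z≡ p≡ = toℕ-injective (trans (toℕ-vertex v)
    (trans (cong₂ (λ i j → c * toℕ i + j) z≡ p≡) (sym (toℕ-vertex w))))

  decode : ∀ v i {j} → j ≤ D → toℕ v ≡ c * i + j → toℕ (zone v) ≡ i × pos v ≡ j
  decode v i {j} j≤D v≡ = *-cancelˡ-≡ _ _ c (+-cancelʳ-≡ j _ _
      (trans (cong (c * toℕ (zone v) +_) (sym pos≡)) (trans (sym (toℕ-vertex v)) v≡))) , pos≡
    where
    pos≡ : pos v ≡ j
    pos≡ = trans (sym (position (toℕ (zone v)) (pos≤D v)))
             (trans (cong (_% c) (trans (sym (toℕ-vertex v)) v≡)) (position i j≤D))

  data Edge (x y : Vertex) : Set where
    first-hub : zone x ≡ zone y → pos x ≡ 0 → pos y ≡ 1 → Edge x y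
    hub-leaf  : zone x ≡ zone y → pos x ≡ 1 → 2 ≤ pos y → Edge x y
    link      : toℕ (zone y) ≡ suc (toℕ (zone x)) → pos x ≡ D → pos y ≡ 0 → Edge x y

  -- The position of the child `y` determines its parent, so computing `parent` there gives the zone
  -- and position of `x`.
  edge : ∀ {x y} → toℕ x ◁ toℕ y → Edge x y
  edge {x} {y} (x<y , py≡x) = cases (toℕ (zone y)) (pos y) refl refl
    where
    cases : ∀ i j → toℕ (zone y) ≡ i → pos y ≡ j → Edge x y
    cases i j zone≡ pos≡ with trans (toℕ-vertex y) (cong₂ (λ i j → c * i + j) zone≡ pos≡)
    -- This `y` is the root, and no vertex precedes it.
    cases zero zero _ _ | y≡ =
      contradiction (subst (toℕ x <_) (trans y≡ (trans (+-identityʳ _) (*-zeroʳ c))) x<y) λ ()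
    cases (suc i) zero zone≡ pos≡ | y≡
      with decode x i ≤-refl (trans (sym py≡x) (trans (cong parent y≡) (parent-first i)))
    ... | zx≡ , px≡ = link (trans zone≡ (cong suc (sym zx≡))) px≡ pos≡
    cases i (suc zero) zone≡ pos≡ | y≡
      with decode x i z≤n (trans (sym py≡x) (trans (cong parent y≡) (parent-spine i z≤n refl)))
    ... | zx≡ , px≡ = first-hub (toℕ-injective (trans zx≡ (sym zone≡))) px≡ pos≡
    cases i (suc (suc j)) zone≡ pos≡ | y≡
      with decode x i (s≤s z≤n) (trans (sym py≡x) (trans (cong parent y≡)
             (parent-leaf i (subst (_≤ D) pos≡ (pos≤D y)))))
    ... | zx≡ , px≡ =
      hub-leaf (toℕ-injective (trans zx≡ (sym zone≡))) px≡ (subst (2 ≤_) (sym pos≡) (s≤s (s≤s z≤n)))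

  Hub : Vertex → Set
  Hub v = pos v ≡ 1

  Hub? : ∀ v → Dec (Hub v)
  Hub? v = pos v ≟ 1

  hub-neighbour : n ≤ D → ∀ {v w} → Hub v → Adj v w → zone w ≡ zone v × ¬ Hub w
  hub-neighbour n≤D {v} {w} v≡1 (inj₁ v◁w) with edge v◁w
  ... | first-hub _ v≡0 _ = contradiction (trans (sym v≡0) v≡1) λ ()
  ... | hub-leaf z≡ _ 2≤w = sym z≡ , λ w≡1 → contradiction (subst (2 ≤_) w≡1 2≤w) λ { (s≤s ()) }
  -- A hub at the start of a link means `D = 1`; then `n ≤ D` leaves a single zone, so there is no
  -- next one.
  ... | link z≡ v≡D _ = contradiction
          (≤-trans (toℕ<n (zone w)) (≤-trans n≤D (≤-reflexive (trans (sym v≡D) v≡1))))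
          (<⇒≱ (≤-trans (s≤s (s≤s z≤n)) (≤-reflexive (cong suc (sym z≡)))))
  hub-neighbour n≤D {v} {w} v≡1 (inj₂ w◁v) with edge w◁v
  ... | first-hub z≡ w≡0 _ = z≡ , λ w≡1 → contradiction (trans (sym w≡0) w≡1) λ ()
  ... | hub-leaf _ _ 2≤v = contradiction (subst (2 ≤_) v≡1 2≤v) λ { (s≤s ()) }
  ... | link _ _ v≡0 = contradiction (trans (sym v≡0) v≡1) λ ()

  data LinkEnds (v w : Vertex) : Set where
    next : pos v ≡ D → pos w ≡ 0 → toℕ (zone w) ≡ suc (toℕ (zone v)) → LinkEnds v w
    prev : pos v ≡ 0 → pos w ≡ D → toℕ (zone v) ≡ suc (toℕ (zone w)) → LinkEnds v w

  nonhub-neighbour : ∀ {v w} → ¬ Hub v → ¬ Hub w → Adj v w → LinkEnds v w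
  nonhub-neighbour v≢1 w≢1 (inj₁ v◁w) with edge v◁w
  ... | first-hub _ _ w≡1 = contradiction w≡1 w≢1
  ... | hub-leaf _ v≡1 _  = contradiction v≡1 v≢1
  ... | link z≡ v≡D w≡0   = next v≡D w≡0 z≡
  nonhub-neighbour v≢1 w≢1 (inj₂ w◁v) with edge w◁v
  ... | first-hub _ _ v≡1 = contradiction v≡1 v≢1
  ... | hub-leaf _ w≡1 _  = contradiction w≡1 w≢1
  ... | link z≡ w≡D v≡0   = prev v≡0 w≡D z≡

  LinkEnds-unique : ∀ {v w w′} → LinkEnds v w → LinkEnds v w′ → w ≡ w′
  LinkEnds-unique (next _ w≡0 z≡) (next _ w′≡0 z′≡) =
    vertex-ext (toℕ-injective (trans z≡ (sym z′≡))) (trans w≡0 (sym w′≡0))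
  LinkEnds-unique (prev _ w≡D z≡) (prev _ w′≡D z′≡) =
    vertex-ext (toℕ-injective (suc-injective (trans (sym z≡) z′≡))) (trans w≡D (sym w′≡D))
  LinkEnds-unique (next v≡D _ _) (prev v≡0 _ _) = contradiction (trans (sym v≡0) v≡D) λ ()
  LinkEnds-unique (prev v≡0 _ _) (next v≡D _ _) = contradiction (trans (sym v≡0) v≡D) λ ()

  -- Deleting the hubs leaves only links, and these form a matching: position `D` leads only to the
  -- next zone and position 0 only to the previous one.
  nonhub-degree≤1 : ∀ v → ¬ Hub v → AtMost 1 (λ w → Adj v w × ¬ Hub w)
  nonhub-degree≤1 v v≢1 = (λ _ → 0) , (λ _ → s≤s z≤n) , λ (vw , w≢1) (vw′ , w′≢1) _ →
    LinkEnds-unique (nonhub-neighbour v≢1 w≢1 vw) (nonhub-neighbour v≢1 w′≢1 vw′)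

  hub-degree : n ≤ D → ∀ {v} → Hub v → AtMost D (Adj v)
  -- The neighbours of a hub stay in its zone and avoid position 1, so `pred` is injective on their
  -- positions and takes values below `D`.
  hub-degree n≤D {v} v≡1 = pred ∘ pos , (λ {w} _ → pred< (pos≤D w)) , inj
    where
    pred< : ∀ {j} → j ≤ D → pred j < D
    pred< {zero}  _   = s≤s z≤n
    pred< {suc j} j≤D = j≤D

    pred-inj : ∀ {j k} → j ≢ 1 → k ≢ 1 → pred j ≡ pred k → j ≡ k
    pred-inj {zero}  {zero}     _   _   _  = refl
    pred-inj {zero}  {suc zero} _   k≢1 _  = contradiction refl k≢1
    pred-inj {suc zero} {zero}  j≢1 _   _  = contradiction refl j≢1
    pred-inj {suc j} {suc k}    _   _   eq = cong suc eq

    inj : ∀ {w w′} → Adj v w → Adj v w′ → pred (pos w) ≡ pred (pos w′) → w ≡ w′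
    inj vw vw′ eq with hub-neighbour n≤D v≡1 vw | hub-neighbour n≤D v≡1 vw′
    ... | z≡ , w≢1 | z′≡ , w′≢1 = vertex-ext (trans z≡ (sym z′≡)) (pred-inj w≢1 w′≢1 eq)

  nonhub-degree : n ≤ D → ∀ {v} → ¬ Hub v → AtMost D (Adj v)
  nonhub-degree n≤D {v} v≢1 = f , bounded , inj
    where
    f : Vertex → ℕ
    -- Label 0 goes to the hub of the zone, label 1 to the other end of a link.
    f w = [ (λ _ → 0) , (λ _ → 1) ]′ (toSum (Hub? w))

    D≢1⇒1<D : D ≢ 1 → 1 < D
    D≢1⇒1<D D≢1 = ≤∧≢⇒< (s≤s z≤n) (D≢1 ∘ sym)

    bounded : ∀ {w} → Adj v w → f w < D
    bounded {w} vw with Hub? w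
    ... | yes _  = s≤s z≤n
    ... | no w≢1 with nonhub-neighbour v≢1 w≢1 vw
    -- For `D = 1` position `D` would be a hub, so a link between non-hubs forces `1 < D` and label
    -- 1 is admissible.
    ...   | next v≡D _ _ = D≢1⇒1<D (v≢1 ∘ trans v≡D)
    ...   | prev _ w≡D _ = D≢1⇒1<D (w≢1 ∘ trans w≡D)

    inj : ∀ {w w′} → Adj v w → Adj v w′ → f w ≡ f w′ → w ≡ w′
    inj {w} {w′} vw vw′ eq with Hub? w | Hub? w′
    ... | yes w≡1 | yes w′≡1 = vertex-ext
            (trans (sym (proj₁ (hub-neighbour n≤D w≡1 (adj-sym {v} {w} vw))))
              (proj₁ (hub-neighbour n≤D w′≡1 (adj-sym {v} {w′} vw′))))
            (trans w≡1 (sym w′≡1))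
    ... | no w≢1 | no w′≢1 =
            LinkEnds-unique (nonhub-neighbour v≢1 w≢1 vw) (nonhub-neighbour v≢1 w′≢1 vw′)
    ... | yes _ | no _ with () ← eq
    ... | no _ | yes _ with () ← eq

  degree≤D : n ≤ D → ∀ v → AtMost D (Adj v)
  degree≤D n≤D v with Hub? v
  ... | yes v≡1 = hub-degree n≤D v≡1
  ... | no v≢1  = nonhub-degree n≤D v≢1

  hubs≤n : AtMost n Hub
  hubs≤n = toℕ ∘ zone , (λ {v} _ → toℕ<n (zone v)) ,
    λ v≡1 w≡1 eq → vertex-ext (toℕ-injective eq) (trans v≡1 (sym w≡1))

  hub : Fin n → Vertex
  hub i = combine i (suc zero)

  leaf : Fin n → Fin D → Vertex
  leaf i j = combine i (punchIn (suc zero) j)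

  -- `punchIn` skips the hub's own position: leaf `zero` is the parent of the hub, the other leaves
  -- are its children.
  hub-adj-leaf : ∀ i j → Adj (hub i) (leaf i j)
  hub-adj-leaf i zero = inj₂ (subst₂ _◁_
    (sym (toℕ-combine i zero)) (sym (toℕ-combine i (suc zero)))
    (+-monoʳ-< (c * toℕ i) ≤-refl , parent-spine (toℕ i) z≤n refl))
  hub-adj-leaf i (suc j) = inj₁ (subst₂ _◁_
    (sym (toℕ-combine i (suc zero))) (sym (toℕ-combine i (suc (suc j))))
    (+-monoʳ-< (c * toℕ i) (s≤s (s≤s z≤n)) , parent-leaf (toℕ i) (s≤s (toℕ<n j))))

  stars : Game.Stars comb n D
  stars = record
    { hub       = hub
    ; leaf      = leaf
    ; adjacent  = hub-adj-leaf
    ; leaf-inj  = λ i eq → punchIn-injective (suc zero) _ _ (combine-injectiveʳ i _ i _ eq)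
    ; zone      = zone
    ; zone-hub  = λ i → cong proj₁ (remQuot-combine i (suc zero))
    ; zone-leaf = λ i j → cong proj₁ (remQuot-combine i (punchIn (suc zero) j))
    }

  no-isolated : Game.NoIsolated comb
  no-isolated v = subst (λ v → ∃ (Adj v)) (combine-remQuot {n} c v)
    (neighbour (zone v) (remainder {n} c v))
    where
    neighbour : ∀ i j → ∃ (Adj (combine {n} {c} i j))
    neighbour i zero          = hub i , adj-sym {hub i} {leaf i zero} (hub-adj-leaf i zero)
    neighbour i (suc zero)    = leaf i zero , hub-adj-leaf i zero
    neighbour i (suc (suc j)) = hub i , adj-sym {hub i} {leaf i (suc j)} (hub-adj-leaf i (suc j))

-- Disjoint unions

module Union (G H : Graph) where
  private
    module G = Graph G
    module H = Graph H
    module U = Graph (G ⊕ H)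
  open Game using (NoIsolated; TriangleFree; Stars)

  split : U.Vertex → G.Vertex ⊎ H.Vertex
  split = splitAt G.order

  unsplit : G.Vertex ⊎ H.Vertex → U.Vertex
  unsplit = join G.order H.order

  split-unsplit : ∀ z → split (unsplit z) ≡ z
  split-unsplit = splitAt-join G.order H.order

  split-injective : Injective _≡_ _≡_ split
  split-injective {x} {y} eq = trans (sym (join-splitAt G.order H.order x))
    (trans (cong unsplit eq) (join-splitAt G.order H.order y))

  unsplit-injective : Injective _≡_ _≡_ unsplit
  unsplit-injective {x} {y} eq = trans (sym (split-unsplit x)) (trans (cong split eq) (split-unsplit y))

  unsplit-adj : ∀ {z w} → Pointwise G.Adj H.Adj z w → U.Adj (unsplit z) (unsplit w)
  unsplit-adj {z} {w} = subst₂ (Pointwise G.Adj H.Adj) (sym (split-unsplit z)) (sym (split-unsplit w))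

  ⊕-no-isolated : NoIsolated G → NoIsolated H → NoIsolated (G ⊕ H)
  ⊕-no-isolated nG nH v = subst (λ v → ∃ (U.Adj v)) (join-splitAt G.order H.order v)
    (neighbour (split v))
    where
    neighbour : ∀ z → ∃ (U.Adj (unsplit z))
    neighbour (inj₁ x) = _ , unsplit-adj (inj₁ (proj₂ (nG x)))
    neighbour (inj₂ y) = _ , unsplit-adj (inj₂ (proj₂ (nH y)))

  ⊕-triangle-free : TriangleFree G → TriangleFree H → TriangleFree (G ⊕ H)
  ⊕-triangle-free tG tH {u} {v} {w} = go
    where
    go : ∀ {x y z} → Pointwise G.Adj H.Adj x y → Pointwise G.Adj H.Adj y z →
         ¬ Pointwise G.Adj H.Adj z x
    go (inj₁ xy) (inj₁ yz) (inj₁ zx) = tG xy yz zx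
    go (inj₂ xy) (inj₂ yz) (inj₂ zx) = tH xy yz zx

  ⊕-stars : ∀ {m₁ m₂ D} → Stars G m₁ D → Stars H m₂ D → Stars (G ⊕ H) (m₁ + m₂) D
  ⊕-stars {m₁} {m₂} {D} S T = record
    { hub       = unsplit ∘ hub ∘ splitAt m₁
    ; leaf      = λ i j → unsplit (leaf (splitAt m₁ i) j)
    ; adjacent  = λ i j → unsplit-adj (adjacent (splitAt m₁ i) j)
    ; leaf-inj  = λ i eq → leaf-inj (splitAt m₁ i) (unsplit-injective eq)
    ; zone      = join m₁ m₂ ∘ zone ∘ split
    ; zone-hub  = λ i → zone-≡ i (hub (splitAt m₁ i)) (zone-hub (splitAt m₁ i))
    ; zone-leaf = λ i j → zone-≡ i (leaf (splitAt m₁ i) j) (zone-leaf (splitAt m₁ i) j)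
    }
    where
    module S = Stars S
    module T = Stars T

    hub : Fin m₁ ⊎ Fin m₂ → G.Vertex ⊎ H.Vertex
    hub = Sum.map S.hub T.hub

    leaf : Fin m₁ ⊎ Fin m₂ → Fin D → G.Vertex ⊎ H.Vertex
    leaf i j = Sum.map (λ i → S.leaf i j) (λ i → T.leaf i j) i

    zone : G.Vertex ⊎ H.Vertex → Fin m₁ ⊎ Fin m₂
    zone = Sum.map S.zone T.zone

    adjacent : ∀ i j → Pointwise G.Adj H.Adj (hub i) (leaf i j)
    adjacent (inj₁ i) j = inj₁ (S.adjacent i j)
    adjacent (inj₂ i) j = inj₂ (T.adjacent i j)

    leaf-inj : ∀ i → Injective _≡_ _≡_ (leaf i)
    leaf-inj (inj₁ i) = S.leaf-inj i ∘ inj₁-injective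
    leaf-inj (inj₂ i) = T.leaf-inj i ∘ inj₂-injective

    zone-hub : ∀ i → zone (hub i) ≡ i
    zone-hub (inj₁ i) = cong inj₁ (S.zone-hub i)
    zone-hub (inj₂ i) = cong inj₂ (T.zone-hub i)

    zone-leaf : ∀ i j → zone (leaf i j) ≡ i
    zone-leaf (inj₁ i) j = cong inj₁ (S.zone-leaf i j)
    zone-leaf (inj₂ i) j = cong inj₂ (T.zone-leaf i j)

    zone-≡ : ∀ i z → zone z ≡ splitAt m₁ i → join m₁ m₂ (zone (split (unsplit z))) ≡ i
    zone-≡ i z eq =
      trans (cong (join m₁ m₂) (trans (cong zone (split-unsplit z)) eq)) (join-splitAt m₁ m₂ i)

  module _ {P : Pred G.Vertex 0ℓ} {Q : Pred H.Vertex 0ℓ} where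

    P⊎Q : Pred U.Vertex 0ℓ
    P⊎Q = [ P , Q ]′ ∘ split

    P⊎Q? : Decidable P → Decidable Q → Decidable P⊎Q
    P⊎Q? P? Q? v with split v
    ... | inj₁ x = P? x
    ... | inj₂ y = Q? y

    ⊕-size : ∀ {s t} → AtMost s P → AtMost t Q → AtMost (s + t) P⊎Q
    ⊕-size ps qt = AtMost-∘ split-injective (AtMost-⊎ ps qt)

    ⊕-degree : ∀ {d} →
      (∀ x → ¬ P x → AtMost d (λ w → G.Adj x w × ¬ P w)) →
      (∀ y → ¬ Q y → AtMost d (λ w → H.Adj y w × ¬ Q w)) →
      ∀ v → ¬ P⊎Q v → AtMost d (λ w → U.Adj v w × ¬ P⊎Q w)
    ⊕-degree {d} dG dH v ¬v = AtMost-∘ split-injective (go (split v) ¬v)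
      where
      go : ∀ z → ¬ [ P , Q ]′ z → AtMost d (λ w → Pointwise G.Adj H.Adj z w × ¬ [ P , Q ]′ w)
      go (inj₁ x) ¬x with dG x ¬x
      -- The label 0 on the other component is a default value: `Pointwise` relates nothing across
      -- the two.
      ... | f , bounded , inj = [ f , (λ _ → 0) ]′ ,
              (λ { (inj₁ xw , ¬w) → bounded (xw , ¬w) }) ,
              λ { (inj₁ xw , ¬w) (inj₁ xw′ , ¬w′) eq → cong inj₁ (inj (xw , ¬w) (xw′ , ¬w′) eq) }
      go (inj₂ y) ¬y with dH y ¬y
      ... | f , bounded , inj = [ (λ _ → 0) , f ]′ ,
              (λ { (inj₂ yw , ¬w) → bounded (yw , ¬w) }) ,
              λ { (inj₂ yw , ¬w) (inj₂ yw′ , ¬w′) eq → cong inj₂ (inj (yw , ¬w) (yw′ , ¬w′) eq) }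

-- Thresholds of combs and of their union

isThreshold : ∀ {G a m D} → Game.TriangleFree G → Game.Stars G m D → a ≤ m → a ≤ D →
  1 ≤ a → AliceWinsAliceStart G a 1 → IsThreshold G a
isThreshold {G} {a} no-triangle stars a≤m a≤D 1≤a wins = 1≤a , wins , λ a′ _ wins′ →
  -- Fewer than `a` moves are fewer than both `m` and `D`, which is where the stars defeat Alice.
  ≮⇒≥ λ a′<a → Game.stars⇒¬aliceWins G no-triangle stars (≤-trans a′<a a≤m) (≤-trans a′<a a≤D) wins′

-- Alice opens with all hubs, which leaves a matching; `n ≤ D` makes the stars large enough to
-- exclude fewer moves.
comb-threshold : ∀ n′ e → suc n′ ≤ suc e → IsThreshold (Comb.comb n′ e) (suc n′)
comb-threshold n′ e n≤D = isThreshold comb-triangle-free stars ≤-refl n≤D (s≤s z≤n)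
    (Game.deletion⇒aliceWins comb Hub? no-isolated
      (λ v ¬hub → AtMost-≤ (s≤s z≤n) (nonhub-degree≤1 v ¬hub)) hubs≤n)
  where open Comb n′ e

corollary3p4 : ∀ (ℓ k p : ℕ) → 1 ≤ ℓ → ℓ ≤ k → k ≤ p → p ≤ ℓ + k →
    Σ[ G₁ ∈ Graph ] Σ[ G₂ ∈ Graph ] Σ[ a₁ ∈ ℕ ] Σ[ a₂ ∈ ℕ ]
    IsCaterpillar G₁ × IsCaterpillar G₂ ×
    IsThreshold G₁ a₁ × IsThreshold G₂ a₂ ×
    a₁ ⊔ a₂ ≡ k ×
    IsThreshold (G₁ ⊕ G₂) p ×
    a₁ + a₂ ≡ k + ℓ
corollary3p4 (suc ℓ′) (suc k′) (suc e) 1≤ℓ ℓ≤k k≤p p≤ℓ+k =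
    -- Hubs have degree `p` in both combs; the first has `k` zones and the second `ℓ`.
    C₁.comb , C₂.comb , k , ℓ ,
    C₁.comb-isCaterpillar , C₂.comb-isCaterpillar ,
    comb-threshold k′ e k≤p , comb-threshold ℓ′ e ℓ≤p ,
    m≥n⇒m⊔n≡m ℓ≤k ,
    isThreshold (λ {u} {v} {w} → no-triangle {u} {v} {w})
      -- The union has `k + ℓ` stars of `p` leaves each, and `p ≤ k + ℓ`.
      (⊕-stars C₁.stars C₂.stars) (≤-trans p≤ℓ+k (≤-reflexive (+-comm ℓ k))) ≤-refl (s≤s z≤n)
      (Game.deletion⇒aliceWins (C₁.comb ⊕ C₂.comb) (P⊎Q? C₁.Hub? early?)
        (⊕-no-isolated C₁.no-isolated C₂.no-isolated)
        (⊕-degree (λ v ¬hub → AtMost-≤ (s≤s z≤n) (C₁.nonhub-degree≤1 v ¬hub))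
                  -- All degrees in the second comb are at most `p`, so even a hub missed by the
                  -- opening can be defended.
                  (λ v _ → AtMost-⊆ proj₁ (C₂.degree≤D ℓ≤p v)))
        (AtMost-≤ (≤-reflexive (m+[n∸m]≡n k≤p)) (⊕-size C₁.hubs≤n early≤t))) ,
    refl
  where
  ℓ k p t : ℕ
  ℓ = suc ℓ′
  k = suc k′
  p = suc e
  t = p ∸ k

  ℓ≤p : ℓ ≤ p
  ℓ≤p = ≤-trans ℓ≤k k≤p

  module C₁ = Comb k′ e
  module C₂ = Comb ℓ′ e
  open Union C₁.comb C₂.comb

  no-triangle : Game.TriangleFree (C₁.comb ⊕ C₂.comb)
  no-triangle {u} {v} {w} = ⊕-triangle-free C₁.comb-triangle-free C₂.comb-triangle-free {u} {v} {w}

  -- With p moves Alice starts by taking all hubs of G₁ and p ∸ k hubs of G₂.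
  Early : Pred (Graph.Vertex C₂.comb) 0ℓ
  Early v = C₂.Hub v × toℕ (C₂.zone v) < t

  early? : Decidable Early
  early? v = C₂.Hub? v ×-dec (toℕ (C₂.zone v) <? t)

  early≤t : AtMost t Early
  early≤t = toℕ ∘ C₂.zone , proj₂ , λ (v≡1 , _) (w≡1 , _) eq →
    C₂.vertex-ext (toℕ-injective eq) (trans v≡1 (sym w≡1))
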